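{- Let $d>2$ be an integer. There is a constant $C_d$ such that for every prime $p$ and every set $\mathcal{O}$ of obstructing unit $d$-hypercubes in $[0,p]^d$, the number of hypercubes in $\mathcal{O}$ that are visible in the $d$-dimensional toy upper bound visibility environment is at most $C_d\,p^{d-\frac1d}\log p$.
   Context: The hypercube $[0,p]^d$ is partitioned into axis-aligned unit hypercubes $\prod_{i=1}^d[a_i,a_i+1]$ with $a_i\in\{0,\dots,p-1\}$; a set $\mathcal{O}$ of them is declared obstructing. For $t=(t_1,\dots,t_{d-1})\in\{0,\dots,p-1\}^{d-1}$ let $\mathcal{P}_t$ be the parallelotope with lower base $[0,1]^{d-1}\times\{0\}$ and lateral edges parallel to (and of the same length as) the segment $E_t$ joining the origin to the characteristic vertex $(t_1,\dots,t_{d-1},p)$. For each integer $0\le k<p$, let $$Q_{t,k}=\prod_{i=1}^{d-1}\Big[\big\lfloor \tfrac{t_ik}{p}\big\rfloor,\big\lfloor \tfrac{t_ik}{p}\big\rfloor+1\Big]\times[k,k+1]$$ be the unit hypercube at height $k$ whose bottom facet $F_{t,k}=Q_{t,k}\cap\{x_d=k\}$ meets $E_t$. Toy upper bound visibility environment: within each parallelotope $\mathcal{P}_t$ one considers only the obstructing hypercubes along $E_t$ (those of the form $Q_{t,k}$), and only the lines of sight parallel to the lateral edges of $\mathcal{P}_t$ starting from its lower base; hypercubes along $E_t$ are seen, and block such lines, through their bottom facets. Precisely, an obstructing hypercube $Q\in\mathcal{O}$ is visible in this environment if for some $t\in\{0,\dots,p-1\}^{d-1}$ and some $0\le k<p$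 we have $Q=Q_{t,k}$ and there is $x\in[0,1]^{d-1}$ such that the segment $\{(x,0)+s(t_1,\dots,t_{d-1},p): 0\le s\le 1\}$ meets $F_{t,k}$ and does not meet $F_{t,k'}$ for any $k'<k$ with $Q_{t,k'}\in\mathcal{O}$. -}

module Defs where

open import Algebra.Bundles using (RawMonoid)
import Algebra.Definitions.RawMonoid as RawMonoidDefs
import Algebra.Definitions.RawSemiring as RawSemiringDefs
open import Data.Fin as Fin using (Fin; toℕ; fromℕ<)
open import Data.Fin.Properties using (toℕ<n; nonZeroIndex)
open import Data.Integer as ℤ using (+_)
open import Data.Nat as ℕ using (ℕ; suc; NonZero)
open import Data.Nat.DivMod using (m<n*o⇒m/o<n)
import Data.Nat.Properties as ℕₚ
open import Data.Product using (Σ-syntax; ∃-syntax; _×_; _,_)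
open import Data.Rational as ℚ using (ℚ; 0ℚ; ½; ↥_; ↧ₙ_)
import Data.Rational.Properties as ℚₚ
open import Data.Rational.Solver using (module +-*-Solver)
open import Data.Vec using (Vec; map; zipWith; last; _∷ʳ_)
open import Data.Vec.Relation.Unary.All using (All)
open import Data.Vec.Relation.Binary.Pointwise.Inductive using (Pointwise)
open import Level using (0ℓ)
open import Relation.Binary.PropositionalEquality
  using (_≡_; refl; sym; cong; subst)
open import Relation.Nullary using (¬_)
open import Relation.Unary using (Pred; _∈_)

fromℕ : ℕ → ℚ
fromℕ n = + n ℚ./ 1

------------------------------------------------------------------------
-- Real numbers: Cauchy sequences of rationals. They are compared with _≈ᴿ_
-- and never with _≡_.

record ℝ : Set where
  constructor mkℝ
  field
    seq    : ℕ → ℚ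
    cauchy : ∀ ε → 0ℚ ℚ.< ε →
             ∃[ N ] ∀ m n → N ℕ.≤ m → N ℕ.≤ n → ℚ.∣ seq m ℚ.- seq n ∣ ℚ.≤ ε

open ℝ public

infix 4 _≤ᴿ_ _≈ᴿ_
infixl 6 _+ᴿ_

_≤ᴿ_ : ℝ → ℝ → Set
x ≤ᴿ y = ∀ ε → 0ℚ ℚ.< ε → ∃[ N ] ∀ n → N ℕ.≤ n → seq x n ℚ.≤ seq y n ℚ.+ ε

_≈ᴿ_ : ℝ → ℝ → Set
x ≈ᴿ y = x ≤ᴿ y × y ≤ᴿ x

fromℚ : ℚ → ℝ
fromℚ q .seq _ = q
fromℚ q .cauchy ε 0<ε = 0 , λ _ _ _ _ →
  subst (ℚ._≤ ε) (sym (cong ℚ.∣_∣ (ℚₚ.+-inverseʳ q))) (ℚₚ.<⇒≤ 0<ε)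

fromℕᴿ : ℕ → ℝ
fromℕᴿ n = fromℚ (fromℕ n)

0ᴿ 1ᴿ : ℝ
0ᴿ = fromℕᴿ 0
1ᴿ = fromℕᴿ 1

private
  half-pos : ∀ ε → 0ℚ ℚ.< ε → 0ℚ ℚ.< ½ ℚ.* ε
  half-pos ε 0<ε =
    subst (ℚ._< ½ ℚ.* ε) (ℚₚ.*-zeroʳ ½) (ℚₚ.*-monoʳ-<-pos ½ 0<ε)

  half+half : ∀ ε → ½ ℚ.* ε ℚ.+ ½ ℚ.* ε ≡ ε
  half+half = solve 1 (λ e → con ½ :* e :+ con ½ :* e := e) refl
    where open +-*-Solver

  regroup : ∀ a b c d → (a ℚ.+ b) ℚ.- (c ℚ.+ d) ≡ (a ℚ.- c) ℚ.+ (b ℚ.- d)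
  regroup = solve 4 (λ a b c d →
    (a :+ b) :+ (:- (c :+ d)) := (a :+ (:- c)) :+ (b :+ (:- d))) refl
    where open +-*-Solver

_+ᴿ_ : ℝ → ℝ → ℝ
(x +ᴿ y) .seq n = seq x n ℚ.+ seq y n
(x +ᴿ y) .cauchy ε 0<ε
  with cauchy x (½ ℚ.* ε) (half-pos ε 0<ε) | cauchy y (½ ℚ.* ε) (half-pos ε 0<ε)
... | M , hx | N , hy = M ℕ.⊔ N , bound
  where
  open ℚₚ.≤-Reasoning
  bound : ∀ m n → M ℕ.⊔ N ℕ.≤ m → M ℕ.⊔ N ℕ.≤ n →
          ℚ.∣ (seq x m ℚ.+ seq y m) ℚ.- (seq x n ℚ.+ seq y n) ∣ ℚ.≤ ε
  bound m n ≤m ≤n = begin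
    ℚ.∣ (seq x m ℚ.+ seq y m) ℚ.- (seq x n ℚ.+ seq y n) ∣
      ≡⟨ cong ℚ.∣_∣ (regroup (seq x m) (seq y m) (seq x n) (seq y n)) ⟩
    ℚ.∣ (seq x m ℚ.- seq x n) ℚ.+ (seq y m ℚ.- seq y n) ∣
      ≤⟨ ℚₚ.∣p+q∣≤∣p∣+∣q∣ (seq x m ℚ.- seq x n) (seq y m ℚ.- seq y n) ⟩
    ℚ.∣ seq x m ℚ.- seq x n ∣ ℚ.+ ℚ.∣ seq y m ℚ.- seq y n ∣
      ≤⟨ ℚₚ.+-mono-≤
           (hx m n (ℕₚ.≤-trans (ℕₚ.m≤m⊔n M N) ≤m) (ℕₚ.≤-trans (ℕₚ.m≤m⊔n M N) ≤n))
           (hy m n (ℕₚ.≤-trans (ℕₚ.m≤n⊔m M N) ≤m) (ℕₚ.≤-trans (ℕₚ.m≤n⊔m M N) ≤n)) ⟩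
    ½ ℚ.* ε ℚ.+ ½ ℚ.* ε
      ≡⟨ half+half ε ⟩
    ε ∎

+ᴿ-rawMonoid : RawMonoid 0ℓ 0ℓ
+ᴿ-rawMonoid = record { Carrier = ℝ ; _≈_ = _≈ᴿ_ ; _∙_ = _+ᴿ_ ; ε = 0ᴿ }

-- n ·ᴿ x is the product of the real x by the natural number n.
open RawMonoidDefs +ᴿ-rawMonoid public using () renaming (_×_ to infixr 8 _·ᴿ_)

------------------------------------------------------------------------
-- Cubes of the grid. In the dimension d = suc n the last coordinate is the
-- height, so that t ranges over Vec (Fin p) n.

-- The cube ∏ᵢ [aᵢ, aᵢ + 1] is represented by its corner a.
Cube : ℕ → ℕ → Set
Cube d p = Vec (Fin p) d

_∈Cube_ : ∀ {d p} → Vec ℝ d → Cube d p → Set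
y ∈Cube a =
  Pointwise (λ yᵢ aᵢ → fromℕᴿ (toℕ aᵢ) ≤ᴿ yᵢ × yᵢ ≤ᴿ fromℕᴿ (suc (toℕ aᵢ))) y a

_∈BottomFacet_ : ∀ {n p} → Vec ℝ (suc n) → Cube (suc n) p → Set
y ∈BottomFacet a = y ∈Cube a × last y ≈ᴿ fromℕᴿ (toℕ (last a))

-- ⌊ t k / p ⌋; the divisor p is nonzero because Fin p is inhabited.
⌊_*_/p⌋ : ∀ {p} → Fin p → Fin p → Fin p
⌊_*_/p⌋ {p} t k = fromℕ< {toℕ t ℕ.* toℕ k ℕ./ p} quotient<p
  where
  instance
    p≢0 : NonZero p
    p≢0 = nonZeroIndex t
  quotient<p : toℕ t ℕ.* toℕ k ℕ./ p ℕ.< p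
  quotient<p = m<n*o⇒m/o<n (ℕₚ.*-mono-< (toℕ<n t) (toℕ<n k))

Q : ∀ {n p} → Vec (Fin p) n → Fin p → Cube (suc n) p
Q t k = map (λ tᵢ → ⌊ tᵢ * k /p⌋) t ∷ʳ k

-- (x, 0) + s (t₁, …, tₙ, p)
sightPoint : ∀ {n p} → Vec (Fin p) n → Vec ℝ n → ℝ → Vec ℝ (suc n)
sightPoint {p = p} t x s =
  zipWith (λ xᵢ vᵢ → xᵢ +ᴿ vᵢ ·ᴿ s) (x ∷ʳ 0ᴿ) (map toℕ t ∷ʳ p)

MeetsFacet : ∀ {n p} → Vec (Fin p) n → Vec ℝ n → Fin p → Set
MeetsFacet t x k =
  ∃[ s ] 0ᴿ ≤ᴿ s × s ≤ᴿ 1ᴿ × sightPoint t x s ∈BottomFacet Q t k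

-- The set 𝒪 is an arbitrary predicate; it is not assumed to be decidable.
Visible : ∀ {n p} → Pred (Cube (suc n) p) 0ℓ → Pred (Cube (suc n) p) 0ℓ
Visible {n} {p} 𝒪 c =
  c ∈ 𝒪 ×
  (Σ[ t ∈ Vec (Fin p) n ] Σ[ k ∈ Fin p ]
     c ≡ Q t k ×
     (Σ[ x ∈ Vec ℝ n ]
        All (λ xᵢ → 0ᴿ ≤ᴿ xᵢ × xᵢ ≤ᴿ 1ᴿ) x ×
        MeetsFacet t x k ×
        (∀ k′ → k′ Fin.< k → Q t k′ ∈ 𝒪 → ¬ MeetsFacet t x k′)))

------------------------------------------------------------------------
-- Comparison with C p^(d - 1/d) log p. The two irrational factors enter
-- through their sets of rational upper bounds.

open RawSemiringDefs ℚ.+-*-rawSemiring using () renaming (_^_ to _^ℚ_)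

-- p^(d - 1/d) ≤ r, where p^(d - 1/d) is the d-th root of p^(d² - 1).
Power≤ : ℕ → ℕ → ℚ → Set
Power≤ p d r = 0ℚ ℚ.≤ r × fromℕ (p ℕ.^ (d ℕ.* d ℕ.∸ 1)) ℚ.≤ r ^ℚ d

-- log₂ p ≤ a / b for ℓ = a / b ≥ 0 in lowest terms, that is, p^b ≤ 2^a. The base 2
-- is immaterial, since a change of base only rescales the constant C.
Log≤ : ℕ → ℚ → Set
Log≤ p ℓ = 0ℚ ℚ.≤ ℓ × p ℕ.^ ↧ₙ ℓ ℕ.≤ 2 ℕ.^ ℤ.∣ ↥ ℓ ∣

-- N ≤ C p^(d - 1/d) log₂ p. For positive reals α and β, the product C α β is
-- the infimum of C r ℓ over the rationals r ≥ α and ℓ ≥ β.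
_≤_·p^[d-1/d]·log[p=_,d=_] : ℕ → ℕ → ℕ → ℕ → Set
N ≤ C ·p^[d-1/d]·log[p= p ,d= d ] =
  ∀ r ℓ → Power≤ p d r → Log≤ p ℓ → fromℕ N ℚ.≤ fromℕ C ℚ.* r ℚ.* ℓ

{-# OPTIONS --safe #-}
-- Projected to the base along E_t, the facet F_{t,k} is the box ∏ᵢ [0, 1 − (tᵢ k mod p) / p].
-- Hence, for fixed t, the cubes Q_{t,k} visible through t correspond to points
-- (k, t₁ k mod p, …, tₙ k mod p) of [0, p)^d forming an antichain: no two of them satisfy
-- k′ < k and tᵢ k′ mod p ≤ tᵢ k mod p for all i. Cut [0, p)^d into m^d cells of side
-- s ≈ p / m, where m ≈ p^(1/d). An antichain meets at most one cell of each of the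
-- (2m)^n diagonals, n = d − 1. Fix one point in each cell that is met. A further point of
-- the cell has some offset (δ, u) from it, with δ ≠ 0, |δ| < s and |uᵢ| < s; as tᵢ δ ≡ uᵢ
-- mod p and p is prime, the offset determines t. So summing over all t yields at most
-- (2m)^n (p^n + (2s)^d) = O(p^(d − 1/d)) visible cubes.
module Submission where

open import Defs
open import Algebra.Bundles using (CommutativeRing)
import Algebra.Definitions.RawSemiring as RawSemiringDefs
import Algebra.Properties.CommutativeSemiring.Exp as Exp
open import Data.Empty using (⊥)
open import Data.Fin as Fin using (Fin; toℕ; fromℕ<; funToFin; finToFun; combine; join; splitAt)
open import Data.Fin.Properties
  using (toℕ<n; toℕ-fromℕ<; toℕ-injective; fromℕ<-injective; finToFun-funToFin;
         combine-injective; splitAt-join; any?; injective⇒≤)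
open import Data.Integer as ℤ using (+_)
import Data.Integer.Properties as ℤₚ
open import Data.Integer.Tactic.RingSolver using (solve-∀)
open import Data.List as List using (List; length; []; _∷_)
open import Data.List.Membership.Propositional.Properties using (∈-lookup)
open import Data.List.Relation.Unary.All as ListAll using (All)
open import Data.List.Relation.Unary.AllPairs using (_∷_)
open import Data.List.Relation.Unary.Unique.Propositional using (Unique)
open import Data.Nat as ℕ using (ℕ; zero; suc; NonZero; _<_; _≤_; _+_; _*_; _∸_; _^_)
open import Data.Nat.Divisibility using (_∣_; divides; >⇒∤)
open import Data.Nat.DivMod
  using (_/_; _%_; m≡m%n+[m/n]*n; m/n*n≤m; m%n<n; /-monoˡ-≤; m<n*o⇒m/o<n)
open import Data.Nat.Primality using (Prime; euclidsLemma; prime⇒nonZero; prime⇒nonTrivial)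
import Data.Nat.Properties as ℕₚ
import Data.Nat.Tactic.RingSolver as ℕ-RingSolver
open import Data.Product using (∃-syntax; Σ-syntax; _×_; _,_; proj₁; proj₂)
open import Data.Rational as ℚ using (0ℚ; 1ℚ; ½)
import Data.Rational.Properties as ℚₚ
open import Data.Rational.Solver using (module +-*-Solver)
import Data.Rational.Unnormalised as ℚᵘ
import Data.Rational.Unnormalised.Properties as ℚᵘₚ
open import Data.Sum using (_⊎_; inj₁; inj₂)
open import Data.Sum.Properties using (inj₁-injective; inj₂-injective)
open import Data.Vec using (Vec; []; _∷_; map; zipWith; last; lookup; _∷ʳ_)
open import Data.Vec.Functional using () renaming (_∷_ to _◂_)
open import Data.Vec.Properties using (last-∷ʳ; tabulate∘lookup; tabulate-cong)
open import Data.Vec.Relation.Binary.Pointwise.Inductive using (Pointwise; []; _∷_)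
open import Data.Vec.Relation.Unary.All as VecAll using ([]; _∷_)
open import Function using (Injective)
open import Level using (0ℓ)
open import Relation.Binary using (tri<; tri≈; tri>)
open import Relation.Binary.PropositionalEquality
open import Relation.Nullary using (¬_; Dec; yes; no; contradiction)
open import Relation.Unary using (Pred; _∈_)

open RawSemiringDefs ℚ.+-*-rawSemiring using () renaming (_^_ to _^ℚ_)
open Exp (CommutativeRing.commutativeSemiring ℚₚ.+-*-commutativeRing)
  using () renaming (^-distrib-* to ^ℚ-distrib-*)

-- Rational and real arithmetic

toℚᵘ-fromℕ : ∀ n → ℚ.toℚᵘ (fromℕ n) ℚᵘ.≃ ℚᵘ.mkℚᵘ (+ n) 0
toℚᵘ-fromℕ n = ℚₚ.toℚᵘ-fromℚᵘ (ℚᵘ.mkℚᵘ (+ n) 0)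

fromℕ-homo-+ : ∀ m n → fromℕ (m + n) ≡ fromℕ m ℚ.+ fromℕ n
fromℕ-homo-+ m n = ℚₚ.toℚᵘ-injective (begin
  ℚ.toℚᵘ (fromℕ (m + n))                    ≈⟨ toℚᵘ-fromℕ (m + n) ⟩
  ℚᵘ.mkℚᵘ (+ (m + n)) 0                     ≈⟨ ℚᵘ.*≡* (cong (ℤ._* + 1) (sym
                                                   (cong₂ ℤ._+_ (ℤₚ.*-identityʳ (+ m)) (ℤₚ.*-identityʳ (+ n))))) ⟩
  ℚᵘ.mkℚᵘ (+ m) 0 ℚᵘ.+ ℚᵘ.mkℚᵘ (+ n) 0      ≈⟨ ℚᵘₚ.+-cong (toℚᵘ-fromℕ m) (toℚᵘ-fromℕ n) ⟨
  ℚ.toℚᵘ (fromℕ m) ℚᵘ.+ ℚ.toℚᵘ (fromℕ n)    ≈⟨ ℚₚ.toℚᵘ-homo-+ (fromℕ m) (fromℕ n) ⟨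
  ℚ.toℚᵘ (fromℕ m ℚ.+ fromℕ n)              ∎)
  where open ℚᵘₚ.≃-Reasoning

fromℕ-homo-* : ∀ m n → fromℕ (m * n) ≡ fromℕ m ℚ.* fromℕ n
fromℕ-homo-* m n = ℚₚ.toℚᵘ-injective (begin
  ℚ.toℚᵘ (fromℕ (m * n))                    ≈⟨ toℚᵘ-fromℕ (m * n) ⟩
  ℚᵘ.mkℚᵘ (+ (m * n)) 0                     ≈⟨ ℚᵘ.*≡* (cong (ℤ._* + 1) (ℤₚ.pos-* m n)) ⟩
  ℚᵘ.mkℚᵘ (+ m) 0 ℚᵘ.* ℚᵘ.mkℚᵘ (+ n) 0      ≈⟨ ℚᵘₚ.*-cong (toℚᵘ-fromℕ m) (toℚᵘ-fromℕ n) ⟨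
  ℚ.toℚᵘ (fromℕ m) ℚᵘ.* ℚ.toℚᵘ (fromℕ n)    ≈⟨ ℚₚ.toℚᵘ-homo-* (fromℕ m) (fromℕ n) ⟨
  ℚ.toℚᵘ (fromℕ m ℚ.* fromℕ n)              ∎)
  where open ℚᵘₚ.≃-Reasoning

fromℕ-mono-≤ : ∀ {m n} → m ≤ n → fromℕ m ℚ.≤ fromℕ n
fromℕ-mono-≤ {m} {n} m≤n = ℚₚ.toℚᵘ-cancel-≤ (begin
  ℚ.toℚᵘ (fromℕ m)    ≃⟨ toℚᵘ-fromℕ m ⟩
  ℚᵘ.mkℚᵘ (+ m) 0     ≤⟨ ℚᵘ.*≤* (ℤₚ.*-monoʳ-≤-nonNeg (+ 1) (ℤ.+≤+ m≤n)) ⟩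
  ℚᵘ.mkℚᵘ (+ n) 0     ≃⟨ toℚᵘ-fromℕ n ⟨
  ℚ.toℚᵘ (fromℕ n)    ∎)
  where open ℚᵘₚ.≤-Reasoning

0≤fromℕ : ∀ n → 0ℚ ℚ.≤ fromℕ n
0≤fromℕ n = fromℕ-mono-≤ {0} {n} ℕ.z≤n

fromℕ-pos : ∀ n .{{_ : NonZero n}} → ℚ.Positive (fromℕ n)
fromℕ-pos (suc n) = ℚ.positive (ℚₚ.<-≤-trans (ℚ.*<* (ℤ.+<+ (ℕ.s≤s ℕ.z≤n))) (fromℕ-mono-≤ {1} {suc n} (ℕ.s≤s ℕ.z≤n)))

fromℕ-*-/ : ∀ k p .{{_ : NonZero p}} → fromℕ p ℚ.* (+ k ℚ./ p) ≡ fromℕ k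
fromℕ-*-/ k (suc p) = ℚₚ.toℚᵘ-injective (begin
  ℚ.toℚᵘ (fromℕ (suc p) ℚ.* (+ k ℚ./ suc p))            ≈⟨ ℚₚ.toℚᵘ-homo-* (fromℕ (suc p)) (+ k ℚ./ suc p) ⟩
  ℚ.toℚᵘ (fromℕ (suc p)) ℚᵘ.* ℚ.toℚᵘ (+ k ℚ./ suc p)    ≈⟨ ℚᵘₚ.*-cong (toℚᵘ-fromℕ (suc p)) (ℚₚ.toℚᵘ-fromℚᵘ (ℚᵘ.mkℚᵘ (+ k) p)) ⟩
  ℚᵘ.mkℚᵘ (+ suc p) 0 ℚᵘ.* ℚᵘ.mkℚᵘ (+ k) p              ≈⟨ ℚᵘ.*≡* (trans (ℤₚ.*-identityʳ (+ suc p ℤ.* + k)) (trans (ℤₚ.*-comm (+ suc p) (+ k)) (cong (λ z → + k ℤ.* + suc z) (sym (ℕₚ.+-identityʳ p))))) ⟩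
  ℚᵘ.mkℚᵘ (+ k) 0                                       ≈⟨ toℚᵘ-fromℕ k ⟨
  ℚ.toℚᵘ (fromℕ k)                                      ∎)
  where open ℚᵘₚ.≃-Reasoning

≤⇒0≤- : ∀ {p q} → p ℚ.≤ q → 0ℚ ℚ.≤ q ℚ.- p
≤⇒0≤- {p} {q} p≤q = subst (ℚ._≤ q ℚ.- p) (ℚₚ.+-inverseʳ p) (ℚₚ.+-monoˡ-≤ (ℚ.- p) p≤q)

0≤-⇒≤ : ∀ {p q} → 0ℚ ℚ.≤ q ℚ.- p → p ℚ.≤ q
0≤-⇒≤ {p} {q} 0≤q-p = subst₂ ℚ._≤_ (ℚₚ.+-identityˡ p)
  (solve 2 (λ p q → (q :+ (:- p)) :+ p := q) refl p q) (ℚₚ.+-monoˡ-≤ p 0≤q-p)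
  where open +-*-Solver

0≤+ : ∀ {p q} → 0ℚ ℚ.≤ p → 0ℚ ℚ.≤ q → 0ℚ ℚ.≤ p ℚ.+ q
0≤+ = ℚₚ.+-mono-≤

0≤* : ∀ {p q} → 0ℚ ℚ.≤ p → 0ℚ ℚ.≤ q → 0ℚ ℚ.≤ p ℚ.* q
0≤* {p} {q} 0≤p 0≤q = subst (ℚ._≤ p ℚ.* q) (ℚₚ.*-zeroʳ p) (ℚₚ.*-monoˡ-≤-nonNeg p {{ℚ.nonNegative 0≤p}} 0≤q)

½+½ : ∀ ε → ½ ℚ.* ε ℚ.+ ½ ℚ.* ε ≡ ε
½+½ = solve 1 (λ e → con ½ :* e :+ con ½ :* e := e) refl
  where open +-*-Solver

0<½* : ∀ {ε} → 0ℚ ℚ.< ε → 0ℚ ℚ.< ½ ℚ.* ε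
0<½* {ε} 0<ε = subst (ℚ._< ½ ℚ.* ε) (ℚₚ.*-zeroʳ ½) (ℚₚ.*-monoʳ-<-pos ½ 0<ε)

≤⇒≤ᴿ : ∀ x y → (∀ n → seq x n ℚ.≤ seq y n) → x ≤ᴿ y
≤⇒≤ᴿ x y x≤y ε 0<ε = 0 , λ n _ →
  ℚₚ.≤-trans (x≤y n) (subst (ℚ._≤ seq y n ℚ.+ ε) (ℚₚ.+-identityʳ (seq y n)) (ℚₚ.+-monoʳ-≤ (seq y n) (ℚₚ.<⇒≤ 0<ε)))

seq-· : ∀ m x n → seq (m ·ᴿ x) n ≡ fromℕ m ℚ.* seq x n
seq-· zero    x n = sym (ℚₚ.*-zeroˡ (seq x n))
seq-· (suc m) x n = begin
  seq x n ℚ.+ seq (m ·ᴿ x) n                ≡⟨ cong₂ ℚ._+_ (sym (ℚₚ.*-identityˡ (seq x n))) (seq-· m x n) ⟩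
  1ℚ ℚ.* seq x n ℚ.+ fromℕ m ℚ.* seq x n    ≡⟨ ℚₚ.*-distribʳ-+ (seq x n) 1ℚ (fromℕ m) ⟨
  (1ℚ ℚ.+ fromℕ m) ℚ.* seq x n              ≡⟨ cong (ℚ._* seq x n) (fromℕ-homo-+ 1 m) ⟨
  fromℕ (suc m) ℚ.* seq x n                 ∎
  where open ≡-Reasoning

-- Cleared of the denominator P, the slack of the conclusion is a nonnegative combination
-- of the slacks of the hypotheses.
ray-bound : ∀ P T A A′ K X σ q δ → 0ℚ ℚ.< P → 0ℚ ℚ.≤ T → T ℚ.≤ P → 0ℚ ℚ.≤ δ →
  T ℚ.* (P ℚ.* q) ℚ.- A′ ℚ.* P ℚ.≤ T ℚ.* K ℚ.- A ℚ.* P →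
  X ℚ.+ T ℚ.* σ ℚ.≤ (1ℚ ℚ.+ A) ℚ.+ δ → K ℚ.≤ P ℚ.* σ ℚ.+ δ →
  X ℚ.+ T ℚ.* q ℚ.≤ (1ℚ ℚ.+ A′) ℚ.+ (δ ℚ.+ δ)
ray-bound P T A A′ K X σ q δ 0<P 0≤T T≤P 0≤δ r′≤r x+tσ≤ k≤ =
  ℚₚ.*-cancelˡ-≤-pos P {{ℚ.positive 0<P}} (0≤-⇒≤ (subst (0ℚ ℚ.≤_) (sym slack)
    (0≤+ (0≤+ (0≤+ (0≤* (ℚₚ.<⇒≤ 0<P) (≤⇒0≤- x+tσ≤)) (0≤* 0≤T (≤⇒0≤- k≤)))
              (0≤* (≤⇒0≤- T≤P) 0≤δ))
         (≤⇒0≤- r′≤r))))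
  where
  open +-*-Solver
  slack : P ℚ.* ((1ℚ ℚ.+ A′) ℚ.+ (δ ℚ.+ δ)) ℚ.- P ℚ.* (X ℚ.+ T ℚ.* q) ≡
    P ℚ.* (((1ℚ ℚ.+ A) ℚ.+ δ) ℚ.- (X ℚ.+ T ℚ.* σ))
    ℚ.+ T ℚ.* ((P ℚ.* σ ℚ.+ δ) ℚ.- K)
    ℚ.+ (P ℚ.- T) ℚ.* δ
    ℚ.+ ((T ℚ.* K ℚ.- A ℚ.* P) ℚ.- (T ℚ.* (P ℚ.* q) ℚ.- A′ ℚ.* P))
  slack = solve 9 (λ P T A A′ K X σ q δ →
    P :* ((con 1ℚ :+ A′) :+ (δ :+ δ)) :+ (:- (P :* (X :+ T :* q))) :=
    P :* (((con 1ℚ :+ A) :+ δ) :+ (:- (X :+ T :* σ)))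
    :+ T :* ((P :* σ :+ δ) :+ (:- K))
    :+ (P :+ (:- T)) :* δ
    :+ ((T :* K :+ (:- (A :* P))) :+ (:- (T :* (P :* q) :+ (:- (A′ :* P))))))
    refl P T A A′ K X σ q δ

-- One coordinate of a line of sight

module _ {p} .{{_ : NonZero p}} where

  -- Division with remainder over the rationals; through it the order on residues enters
  -- `upper-side`.
  residue : ∀ t k → fromℕ t ℚ.* fromℕ k ℚ.- fromℕ (t * k / p) ℚ.* fromℕ p ≡ fromℕ (t * k % p)
  residue t k = begin
    fromℕ t ℚ.* fromℕ k ℚ.- fromℕ a ℚ.* fromℕ p      ≡⟨ cong₂ ℚ._-_ (fromℕ-homo-* t k) (fromℕ-homo-* a p) ⟨
    fromℕ (t * k) ℚ.- fromℕ (a * p)                  ≡⟨ cong (λ z → fromℕ z ℚ.- fromℕ (a * p)) (m≡m%n+[m/n]*n (t * k) p) ⟩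
    fromℕ (r + a * p) ℚ.- fromℕ (a * p)              ≡⟨ cong (ℚ._- fromℕ (a * p)) (fromℕ-homo-+ r (a * p)) ⟩
    (fromℕ r ℚ.+ fromℕ (a * p)) ℚ.- fromℕ (a * p)    ≡⟨ solve 2 (λ r b → (r :+ b) :+ (:- b) := r) refl (fromℕ r) (fromℕ (a * p)) ⟩
    fromℕ r                                          ∎
    where
    open ≡-Reasoning
    open +-*-Solver
    a = t * k / p
    r = t * k % p

-- h = k′ / p is the parameter at which a line of sight reaches the height k′.
module AtHeight {p} .{{_ : NonZero p}} (k′ : ℕ) (h : ℝ)
  (ph≡k′ : ∀ n → fromℕ p ℚ.* seq h n ≡ fromℕ k′) where

  seq-top : ∀ n → seq (0ᴿ +ᴿ p ·ᴿ h) n ≡ fromℕ k′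
  seq-top n = trans (ℚₚ.+-identityˡ _) (trans (seq-· p h n) (ph≡k′ n))

  0≤h : 0ᴿ ≤ᴿ h
  0≤h = ≤⇒≤ᴿ 0ᴿ h λ n →
    ℚₚ.*-cancelˡ-≤-pos (fromℕ p) {{fromℕ-pos p}}
      (subst₂ ℚ._≤_ (sym (ℚₚ.*-zeroʳ (fromℕ p))) (sym (ph≡k′ n)) (0≤fromℕ k′))

  h≤1 : k′ ≤ p → h ≤ᴿ 1ᴿ
  h≤1 k′≤p = ≤⇒≤ᴿ h 1ᴿ λ n →
    ℚₚ.*-cancelˡ-≤-pos (fromℕ p) {{fromℕ-pos p}}
      (subst₂ ℚ._≤_ (sym (ph≡k′ n)) (sym (ℚₚ.*-identityʳ (fromℕ p))) (fromℕ-mono-≤ k′≤p))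

  k′≤top : fromℕᴿ k′ ≤ᴿ 0ᴿ +ᴿ p ·ᴿ h
  k′≤top = ≤⇒≤ᴿ (fromℕᴿ k′) (0ᴿ +ᴿ p ·ᴿ h) λ n → ℚₚ.≤-reflexive (sym (seq-top n))

  top≤k′ : 0ᴿ +ᴿ p ·ᴿ h ≤ᴿ fromℕᴿ k′
  top≤k′ = ≤⇒≤ᴿ (0ᴿ +ᴿ p ·ᴿ h) (fromℕᴿ k′) λ n → ℚₚ.≤-reflexive (seq-top n)

  top≤1+k′ : 0ᴿ +ᴿ p ·ᴿ h ≤ᴿ fromℕᴿ (suc k′)
  top≤1+k′ = ≤⇒≤ᴿ (0ᴿ +ᴿ p ·ᴿ h) (fromℕᴿ (suc k′)) λ n →
    ℚₚ.≤-trans (ℚₚ.≤-reflexive (seq-top n)) (fromℕ-mono-≤ (ℕₚ.n≤1+n k′))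

  -- `⌊t k′ / p⌋ ≤ t k′ / p = t h`, and `x ≥ 0` only adds to this. So the lower wall of the box
  -- never excludes a line of sight.
  lower-side : ∀ t x → 0ᴿ ≤ᴿ x → fromℕᴿ (t * k′ / p) ≤ᴿ x +ᴿ t ·ᴿ h
  lower-side t x 0≤x ε 0<ε with 0≤x ε 0<ε
  ... | N , 0≤xₙ = N , bound
    where
    open ℚₚ.≤-Reasoning
    open +-*-Solver
    a = t * k′ / p
    a≤th : ∀ n → fromℕ a ℚ.≤ fromℕ t ℚ.* seq h n
    a≤th n = ℚₚ.*-cancelˡ-≤-pos (fromℕ p) {{fromℕ-pos p}} (begin
      fromℕ p ℚ.* fromℕ a                  ≡⟨ ℚₚ.*-comm (fromℕ p) (fromℕ a) ⟩
      fromℕ a ℚ.* fromℕ p                  ≡⟨ fromℕ-homo-* a p ⟨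
      fromℕ (a * p)                        ≤⟨ fromℕ-mono-≤ (m/n*n≤m (t * k′) p) ⟩
      fromℕ (t * k′)                       ≡⟨ fromℕ-homo-* t k′ ⟩
      fromℕ t ℚ.* fromℕ k′                 ≡⟨ cong (fromℕ t ℚ.*_) (ph≡k′ n) ⟨
      fromℕ t ℚ.* (fromℕ p ℚ.* seq h n)    ≡⟨ solve 3 (λ t p q → t :* (p :* q) := p :* (t :* q)) refl
                                                (fromℕ t) (fromℕ p) (seq h n) ⟩
      fromℕ p ℚ.* (fromℕ t ℚ.* seq h n)    ∎)
    bound : ∀ n → N ≤ n → fromℕ a ℚ.≤ (seq x n ℚ.+ seq (t ·ᴿ h) n) ℚ.+ ε
    bound n N≤n = begin
      fromℕ a                                    ≡⟨ ℚₚ.+-identityˡ (fromℕ a) ⟨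
      0ℚ ℚ.+ fromℕ a                             ≤⟨ ℚₚ.+-mono-≤ (0≤xₙ n N≤n) (a≤th n) ⟩
      (seq x n ℚ.+ ε) ℚ.+ fromℕ t ℚ.* seq h n    ≡⟨ solve 3 (λ a b c → (a :+ b) :+ c := (a :+ c) :+ b) refl
                                                      (seq x n) ε (fromℕ t ℚ.* seq h n) ⟩
      (seq x n ℚ.+ fromℕ t ℚ.* seq h n) ℚ.+ ε    ≡⟨ cong (λ z → (seq x n ℚ.+ z) ℚ.+ ε) (seq-· t h n) ⟨
      (seq x n ℚ.+ seq (t ·ᴿ h) n) ℚ.+ ε         ∎

  -- At height `k` the upper wall says `x ≤ 1 − (t k mod p) / p`; a smaller residue at `k′` relaxes
  -- this condition. The two real inequalities are each used with error `½ ε`; the error in the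
  -- height is scaled by `t / p ≤ 1`, so the total stays within `ε`.
  upper-side : ∀ t k x s → t ≤ p → t * k′ % p ≤ t * k % p →
    fromℕᴿ k ≤ᴿ 0ᴿ +ᴿ p ·ᴿ s →
    x +ᴿ t ·ᴿ s ≤ᴿ fromℕᴿ (suc (t * k / p)) →
    x +ᴿ t ·ᴿ h ≤ᴿ fromℕᴿ (suc (t * k′ / p))
  upper-side t k x s t≤p r′≤r k≤ x≤ ε 0<ε
    with k≤ (½ ℚ.* ε) (0<½* 0<ε) | x≤ (½ ℚ.* ε) (0<½* 0<ε)
  ... | M , hk | N , hx = M ℕ.⊔ N , bound
    where
    open ℚₚ.≤-Reasoning
    a = t * k / p
    a′ = t * k′ / p
    δ = ½ ℚ.* ε
    residues : ∀ n → fromℕ t ℚ.* (fromℕ p ℚ.* seq h n) ℚ.- fromℕ a′ ℚ.* fromℕ p ℚ.≤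
                     fromℕ t ℚ.* fromℕ k ℚ.- fromℕ a ℚ.* fromℕ p
    residues n = subst₂ ℚ._≤_
      (sym (trans (cong (λ z → fromℕ t ℚ.* z ℚ.- fromℕ a′ ℚ.* fromℕ p) (ph≡k′ n)) (residue t k′)))
      (sym (residue t k)) (fromℕ-mono-≤ r′≤r)
    bound : ∀ n → M ℕ.⊔ N ≤ n → seq x n ℚ.+ seq (t ·ᴿ h) n ℚ.≤ fromℕ (suc a′) ℚ.+ ε
    bound n ≤n = begin
      seq x n ℚ.+ seq (t ·ᴿ h) n
        ≡⟨ cong (seq x n ℚ.+_) (seq-· t h n) ⟩
      seq x n ℚ.+ fromℕ t ℚ.* seq h n
        ≤⟨ ray-bound (fromℕ p) (fromℕ t) (fromℕ a) (fromℕ a′) (fromℕ k) (seq x n) (seq s n) (seq h n) δ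
             (ℚₚ.positive⁻¹ (fromℕ p) {{fromℕ-pos p}}) (0≤fromℕ t) (fromℕ-mono-≤ t≤p)
             (ℚₚ.<⇒≤ (0<½* 0<ε)) (residues n)
             (subst₂ (λ y z → seq x n ℚ.+ y ℚ.≤ z ℚ.+ δ) (seq-· t s n) (fromℕ-homo-+ 1 a)
               (hx n (ℕₚ.≤-trans (ℕₚ.m≤n⊔m M N) ≤n)))
             (subst (λ y → fromℕ k ℚ.≤ y ℚ.+ δ) (trans (ℚₚ.+-identityˡ _) (seq-· p s n))
               (hk n (ℕₚ.≤-trans (ℕₚ.m≤m⊔n M N) ≤n))) ⟩
      (1ℚ ℚ.+ fromℕ a′) ℚ.+ (δ ℚ.+ δ)
        ≡⟨ cong₂ ℚ._+_ (sym (fromℕ-homo-+ 1 a′)) (½+½ ε) ⟩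
      fromℕ (suc a′) ℚ.+ ε ∎

-- Monotonicity of the facets

module _ {a b ℓ} {A : Set a} {B : Set b} {R : A → B → Set ℓ} where

  Pointwise-∷ʳ⁺ : ∀ {n} {xs : Vec A n} {ys : Vec B n} {x y} →
    Pointwise R xs ys → R x y → Pointwise R (xs ∷ʳ x) (ys ∷ʳ y)
  Pointwise-∷ʳ⁺ []       r = r ∷ []
  Pointwise-∷ʳ⁺ (q ∷ qs) r = q ∷ Pointwise-∷ʳ⁺ qs r

  Pointwise-∷ʳ⁻ : ∀ {n} (xs : Vec A n) (ys : Vec B n) {x y} →
    Pointwise R (xs ∷ʳ x) (ys ∷ʳ y) → Pointwise R xs ys
  Pointwise-∷ʳ⁻ []       []       _        = []
  Pointwise-∷ʳ⁻ (_ ∷ xs) (_ ∷ ys) (q ∷ qs) = q ∷ Pointwise-∷ʳ⁻ xs ys qs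

zipWith-∷ʳ : ∀ {a b c} {A : Set a} {B : Set b} {C : Set c} (f : A → B → C) {n}
  (xs : Vec A n) (ys : Vec B n) x y → zipWith f (xs ∷ʳ x) (ys ∷ʳ y) ≡ zipWith f xs ys ∷ʳ f x y
zipWith-∷ʳ f []       []       x y = refl
zipWith-∷ʳ f (_ ∷ xs) (_ ∷ ys) x y = cong (_ ∷_) (zipWith-∷ʳ f xs ys x y)

module _ {p} .{{_ : NonZero p}} where

  base : ∀ {n} → Vec (Fin p) n → Vec ℝ n → ℝ → Vec ℝ n
  base t x s = zipWith (λ xᵢ vᵢ → xᵢ +ᴿ vᵢ ·ᴿ s) x (map toℕ t)

  floors : ∀ {n} → Vec (Fin p) n → Fin p → Vec (Fin p) n
  floors t k = map (λ tᵢ → ⌊ tᵢ * k /p⌋) t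

  InSlab : ℝ → Fin p → Set
  InSlab y a = fromℕᴿ (toℕ a) ≤ᴿ y × y ≤ᴿ fromℕᴿ (suc (toℕ a))

  toℕ-⌊*/p⌋ : ∀ (t k : Fin p) → toℕ ⌊ t * k /p⌋ ≡ toℕ t * toℕ k / p
  toℕ-⌊*/p⌋ t k = toℕ-fromℕ< _

  sightPoint-∷ʳ : ∀ {n} (t : Vec (Fin p) n) x s → sightPoint t x s ≡ base t x s ∷ʳ (0ᴿ +ᴿ p ·ᴿ s)
  sightPoint-∷ʳ t x s = zipWith-∷ʳ _ x (map toℕ t) 0ᴿ p

  last-sightPoint : ∀ {n} (t : Vec (Fin p) n) x s → last (sightPoint t x s) ≡ 0ᴿ +ᴿ p ·ᴿ s
  last-sightPoint t x s = trans (cong last (sightPoint-∷ʳ t x s)) (last-∷ʳ (0ᴿ +ᴿ p ·ᴿ s) (base t x s))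

  last-Q : ∀ {n} (t : Vec (Fin p) n) k → last (Q t k) ≡ k
  last-Q t k = last-∷ʳ k (floors t k)

  module _ (k k′ : Fin p) (s h : ℝ) (ph≡k′ : ∀ n → fromℕ p ℚ.* seq h n ≡ fromℕ (toℕ k′))
    (k≤ps : fromℕᴿ (toℕ k) ≤ᴿ 0ᴿ +ᴿ p ·ᴿ s) where

    open AtHeight (toℕ k′) h ph≡k′

    lower-slabs : ∀ {n} (t : Vec (Fin p) n) (x : Vec ℝ n) →
      VecAll.All (λ xᵢ → 0ᴿ ≤ᴿ xᵢ × xᵢ ≤ᴿ 1ᴿ) x →
      (∀ i → toℕ (lookup t i) * toℕ k′ % p ≤ toℕ (lookup t i) * toℕ k % p) →
      Pointwise InSlab (base t x s) (floors t k) →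
      Pointwise InSlab (base t x h) (floors t k′)
    lower-slabs [] [] [] r′≤r [] = []
    lower-slabs (t ∷ ts) (x ∷ xs) ((0≤x , _) ∷ 0≤xs) r′≤r ((_ , x≤) ∷ xs≤) =
      ( subst (λ a → fromℕᴿ a ≤ᴿ x +ᴿ toℕ t ·ᴿ h) (sym (toℕ-⌊*/p⌋ t k′)) (lower-side (toℕ t) x 0≤x)
      , subst (λ a → x +ᴿ toℕ t ·ᴿ h ≤ᴿ fromℕᴿ (suc a)) (sym (toℕ-⌊*/p⌋ t k′))
          (upper-side (toℕ t) (toℕ k) x s (ℕₚ.<⇒≤ (toℕ<n t)) (r′≤r Fin.zero) k≤ps
            (subst (λ a → x +ᴿ toℕ t ·ᴿ s ≤ᴿ fromℕᴿ (suc a)) (toℕ-⌊*/p⌋ t k) x≤))) ∷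
      lower-slabs ts xs 0≤xs (λ i → r′≤r (Fin.suc i)) xs≤

  module _ {n} (t : Vec (Fin p) n) (x : Vec ℝ n) (k k′ : Fin p)
    (0≤x≤1 : VecAll.All (λ xᵢ → 0ᴿ ≤ᴿ xᵢ × xᵢ ≤ᴿ 1ᴿ) x)
    (r′≤r : ∀ i → toℕ (lookup t i) * toℕ k′ % p ≤ toℕ (lookup t i) * toℕ k % p) where

    -- The base point `x` is kept and only the parameter moves, from `s` to `h`.
    meetsFacet-at : ∀ h → (∀ n → fromℕ p ℚ.* seq h n ≡ fromℕ (toℕ k′)) →
      MeetsFacet t x k → MeetsFacet t x k′
    meetsFacet-at h ph≡k′ (s , _ , _ , s∈cube , _ , k≤last) =
      h , 0≤h , h≤1 (ℕₚ.<⇒≤ (toℕ<n k′)) , h∈cube , h∈facet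
      where
      open AtHeight (toℕ k′) h ph≡k′
      slabs : Pointwise InSlab (base t x s) (floors t k)
      slabs = Pointwise-∷ʳ⁻ (base t x s) (floors t k) {0ᴿ +ᴿ p ·ᴿ s} {k}
        (subst (λ y → Pointwise InSlab y (Q t k)) (sightPoint-∷ʳ t x s) s∈cube)
      slabs′ : Pointwise InSlab (base t x h) (floors t k′)
      slabs′ = lower-slabs k k′ s h ph≡k′
        (subst₂ (λ y a → fromℕᴿ (toℕ a) ≤ᴿ y) (last-sightPoint t x s) (last-Q t k) k≤last)
        t x 0≤x≤1 r′≤r slabs
      h∈cube : sightPoint t x h ∈Cube Q t k′
      h∈cube = subst (λ y → Pointwise InSlab y (Q t k′)) (sym (sightPoint-∷ʳ t x h))
        (Pointwise-∷ʳ⁺ {xs = base t x h} {ys = floors t k′} {x = 0ᴿ +ᴿ p ·ᴿ h} {y = k′}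
          slabs′ (k′≤top , top≤1+k′))
      h∈facet : last (sightPoint t x h) ≈ᴿ fromℕᴿ (toℕ (last (Q t k′)))
      h∈facet = subst₂ (λ y a → y ≈ᴿ fromℕᴿ (toℕ a)) (sym (last-sightPoint t x h)) (sym (last-Q t k′))
        (top≤k′ , k′≤top)

    -- Smaller residues mean a larger box in the base, so the box of `k` is contained in that of
    -- `k′`. If moreover `k′ < k` and the cube at `k′` is obstructing, it hides the one at `k`
    -- completely.
    meetsFacet-antitone : MeetsFacet t x k → MeetsFacet t x k′
    meetsFacet-antitone = meetsFacet-at (fromℚ (+ toℕ k′ ℚ./ p)) (λ _ → fromℕ-*-/ (toℕ k′) p)

-- Counting antichains

∣+m-+n∣<o : ∀ {m n o} → m < o → n < o → ℤ.∣ + m ℤ.- + n ∣ < o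
∣+m-+n∣<o {m} {n} m<o n<o with ℕₚ.≤-total m n
... | inj₁ m≤n = ℕₚ.≤-<-trans (ℕₚ.≤-reflexive (trans (cong ℤ.∣_∣ (ℤₚ.m-n≡m⊖n m n)) (ℤₚ.∣⊖∣-≤ m≤n)))
                   (ℕₚ.≤-<-trans (ℕₚ.m∸n≤m n m) n<o)
... | inj₂ n≤m = ℕₚ.≤-<-trans (ℕₚ.≤-reflexive (trans (cong ℤ.∣_∣ (ℤₚ.m-n≡m⊖n m n)) (trans (ℤₚ.∣m⊖n∣≡∣n⊖m∣ m n) (ℤₚ.∣⊖∣-≤ n≤m))))
                   (ℕₚ.≤-<-trans (ℕₚ.m∸n≤m m n) m<o)

-- The only multiple of `p` of absolute value less than `p` is zero.
∣difference⇒≡ : ∀ {p m n} → m < p → n < p → p ∣ ℤ.∣ + m ℤ.- + n ∣ → m ≡ n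
∣difference⇒≡ {p} {m} {n} m<p n<p p∣ with ℤ.∣ + m ℤ.- + n ∣ in eq | ∣+m-+n∣<o m<p n<p
... | zero  | _   = ℤₚ.+-injective (ℤₚ.i-j≡0⇒i≡j (+ m) (+ n) (ℤₚ.∣i∣≡0⇒i≡0 eq))
... | suc d | d<p = contradiction p∣ (>⇒∤ d<p)

pos-%-/ : ∀ m p .{{_ : NonZero p}} → + m ≡ + (m % p) ℤ.+ + (m / p) ℤ.* + p
pos-%-/ m p = trans (cong +_ (m≡m%n+[m/n]*n m p))
  (trans (ℤₚ.pos-+ (m % p) (m / p * p)) (cong (ℤ._+_ (+ (m % p))) (ℤₚ.pos-* (m / p) p)))

module _ {p} .{{_ : NonZero p}} (p-prime : Prime p) where

  -- The two equations say that t (k − k₀) ≡ t′ (k′ − k′₀) mod p and k − k₀ = k′ − k′₀, with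
  -- both sides moved so that no subtraction occurs.
  slope-unique : ∀ {t t′ k k₀ k′ k′₀} → t < p → t′ < p → k < p → k₀ < p → k ≢ k₀ →
    k + k′₀ ≡ k′ + k₀ →
    t * k % p + t′ * k′₀ % p ≡ t′ * k′ % p + t * k₀ % p → t ≡ t′
  slope-unique {t} {t′} {k} {k₀} {k′} {k′₀} t<p t′<p k<p k₀<p k≢k₀ δ≡ r≡
    -- The remainders cancel in `(t − t′) (k − k₀)`, leaving `z * p` with `z` built from the
    -- quotients. Primality then puts `p` into one of the two factors.
    with euclidsLemma ℤ.∣ + t ℤ.- + t′ ∣ ℤ.∣ + k ℤ.- + k₀ ∣ p-prime
           (divides ℤ.∣ z ∣ (trans (sym (ℤₚ.abs-* (+ t ℤ.- + t′) (+ k ℤ.- + k₀)))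
             (trans (cong ℤ.∣_∣ factor) (ℤₚ.abs-* z (+ p)))))
    where
    q₁ = + (t * k / p)
    q₂ = + (t * k₀ / p)
    q₃ = + (t′ * k′ / p)
    q₄ = + (t′ * k′₀ / p)
    r₁ = + (t * k % p)
    r₂ = + (t * k₀ % p)
    r₃ = + (t′ * k′ % p)
    r₄ = + (t′ * k′₀ % p)
    z = q₁ ℤ.- q₂ ℤ.- (q₃ ℤ.- q₄)
    divMod : ∀ a b → + a ℤ.* + b ≡ + (a * b % p) ℤ.+ + (a * b / p) ℤ.* + p
    divMod a b = trans (sym (ℤₚ.pos-* a b)) (pos-%-/ (a * b) p)
    expand : ∀ t t′ k k₀ k′ k′₀ → (t ℤ.- t′) ℤ.* (k ℤ.- k₀) ≡
      ((t ℤ.* k ℤ.- t ℤ.* k₀) ℤ.- (t′ ℤ.* k′ ℤ.- t′ ℤ.* k′₀)) ℤ.+ t′ ℤ.* ((k′ ℤ.+ k₀) ℤ.- (k ℤ.+ k′₀))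
    expand = solve-∀
    collect : ∀ r₁ r₂ r₃ r₄ q₁ q₂ q₃ q₄ p →
      (((r₁ ℤ.+ q₁ ℤ.* p) ℤ.- (r₂ ℤ.+ q₂ ℤ.* p)) ℤ.- ((r₃ ℤ.+ q₃ ℤ.* p) ℤ.- (r₄ ℤ.+ q₄ ℤ.* p))) ≡
      ((r₁ ℤ.+ r₄) ℤ.- (r₃ ℤ.+ r₂)) ℤ.+ (q₁ ℤ.- q₂ ℤ.- (q₃ ℤ.- q₄)) ℤ.* p
    collect = solve-∀
    vanish : ∀ a b c d → a + b ≡ c + d → (+ a ℤ.+ + b) ℤ.- (+ c ℤ.+ + d) ≡ + 0
    vanish a b c d e = ℤₚ.i≡j⇒i-j≡0 (trans (sym (ℤₚ.pos-+ a b)) (trans (cong +_ e) (ℤₚ.pos-+ c d)))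
    open ≡-Reasoning
    factor : (+ t ℤ.- + t′) ℤ.* (+ k ℤ.- + k₀) ≡ z ℤ.* + p
    factor = begin
      (+ t ℤ.- + t′) ℤ.* (+ k ℤ.- + k₀)
        ≡⟨ expand (+ t) (+ t′) (+ k) (+ k₀) (+ k′) (+ k′₀) ⟩
      ((+ t ℤ.* + k ℤ.- + t ℤ.* + k₀) ℤ.- (+ t′ ℤ.* + k′ ℤ.- + t′ ℤ.* + k′₀)) ℤ.+ + t′ ℤ.* ((+ k′ ℤ.+ + k₀) ℤ.- (+ k ℤ.+ + k′₀))
        ≡⟨ cong₂ ℤ._+_ (cong₂ ℤ._-_ (cong₂ ℤ._-_ (divMod t k) (divMod t k₀)) (cong₂ ℤ._-_ (divMod t′ k′) (divMod t′ k′₀)))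
             (trans (cong (+ t′ ℤ.*_) (vanish k′ k₀ k k′₀ (sym δ≡))) (ℤₚ.*-zeroʳ (+ t′))) ⟩
      (((r₁ ℤ.+ q₁ ℤ.* + p) ℤ.- (r₂ ℤ.+ q₂ ℤ.* + p)) ℤ.- ((r₃ ℤ.+ q₃ ℤ.* + p) ℤ.- (r₄ ℤ.+ q₄ ℤ.* + p))) ℤ.+ + 0
        ≡⟨ ℤₚ.+-identityʳ _ ⟩
      (((r₁ ℤ.+ q₁ ℤ.* + p) ℤ.- (r₂ ℤ.+ q₂ ℤ.* + p)) ℤ.- ((r₃ ℤ.+ q₃ ℤ.* + p) ℤ.- (r₄ ℤ.+ q₄ ℤ.* + p)))
        ≡⟨ collect r₁ r₂ r₃ r₄ q₁ q₂ q₃ q₄ (+ p) ⟩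
      ((r₁ ℤ.+ r₄) ℤ.- (r₃ ℤ.+ r₂)) ℤ.+ z ℤ.* + p
        ≡⟨ cong (ℤ._+ z ℤ.* + p) (vanish (t * k % p) (t′ * k′₀ % p) (t′ * k′ % p) (t * k₀ % p) r≡) ⟩
      + 0 ℤ.+ z ℤ.* + p
        ≡⟨ ℤₚ.+-identityˡ _ ⟩
      z ℤ.* + p ∎
  ... | inj₁ p∣t-t′ = ∣difference⇒≡ t<p t′<p p∣t-t′
  ... | inj₂ p∣k-k₀ = contradiction (∣difference⇒≡ k<p k₀<p p∣k-k₀) k≢k₀

-- One half of `|m − n| < o` for two points of one cell, free of subtraction; exchanging `m` and `n`
-- gives the other half.
m/o≡n/o⇒m<n+o : ∀ {m n o} .{{_ : NonZero o}} → m / o ≡ n / o → m < n + o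
m/o≡n/o⇒m<n+o {m} {n} {o} eq = begin-strict
  m                    ≡⟨ m≡m%n+[m/n]*n m o ⟩
  m % o + m / o * o    <⟨ ℕₚ.+-monoˡ-< (m / o * o) (m%n<n m o) ⟩
  o + m / o * o        ≡⟨ cong (λ q → o + q * o) eq ⟩
  o + n / o * o        ≤⟨ ℕₚ.+-monoʳ-≤ o (m/n*n≤m n o) ⟩
  o + n                ≡⟨ ℕₚ.+-comm o n ⟩
  n + o                ∎
  where open ℕₚ.≤-Reasoning

m/o<n/o⇒m<n : ∀ {m n o} .{{_ : NonZero o}} → m / o < n / o → m < n
m/o<n/o⇒m<n {m} {n} {o} lt = ℕₚ.≰⇒> λ n≤m → ℕₚ.<⇒≱ lt (/-monoˡ-≤ o n≤m)

-- A signed difference of absolute value less than `o` is encoded as a natural number by adding `o`;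
-- this bounds the code.
m+o∸n<o+o : ∀ {m n o} → m < n + o → n < m + o → m + o ∸ n < o + o
m+o∸n<o+o {m} {n} {o} m<n+o n<m+o = begin-strict
  m + o ∸ n          <⟨ ℕₚ.∸-monoˡ-< (ℕₚ.+-monoˡ-< o m<n+o) (ℕₚ.<⇒≤ n<m+o) ⟩
  n + o + o ∸ n      ≡⟨ cong (_∸ n) (ℕₚ.+-assoc n o o) ⟩
  n + (o + o) ∸ n    ≡⟨ ℕₚ.m+n∸m≡n n (o + o) ⟩
  o + o              ∎
  where open ℕₚ.≤-Reasoning

-- The hypotheses make the truncated subtractions exact, so the code determines the signed
-- difference. The conclusion has the subtraction-free form that `slope-unique` takes.
m+o∸n-injective : ∀ {m n m′ n′ o} → n < m + o → n′ < m′ + o →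
  m + o ∸ n ≡ m′ + o ∸ n′ → m + n′ ≡ m′ + n
m+o∸n-injective {m} {n} {m′} {n′} {o} n< n′< eq = ℕₚ.+-cancelʳ-≡ o (m + n′) (m′ + n) (begin
  m + n′ + o              ≡⟨ swap m n′ o ⟩
  m + o + n′              ≡⟨ cong (_+ n′) (ℕₚ.m∸n+n≡m (ℕₚ.<⇒≤ n<)) ⟨
  m + o ∸ n + n + n′      ≡⟨ swap (m + o ∸ n) n n′ ⟩
  m + o ∸ n + n′ + n      ≡⟨ cong (λ x → x + n′ + n) eq ⟩
  m′ + o ∸ n′ + n′ + n    ≡⟨ cong (_+ n) (ℕₚ.m∸n+n≡m (ℕₚ.<⇒≤ n′<)) ⟩
  m′ + o + n              ≡⟨ swap m′ o n ⟩
  m′ + n + o              ∎)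
  where
  open ≡-Reasoning
  swap : ∀ a b c → a + b + c ≡ a + c + b
  swap a b c = trans (ℕₚ.+-assoc a b c) (trans (cong (λ x → a + x) (ℕₚ.+-comm b c)) (sym (ℕₚ.+-assoc a c b)))

-- Injective codes and class representatives

funToFin-injective : ∀ {m n} {f g : Fin m → Fin n} → funToFin f ≡ funToFin g → ∀ i → f i ≡ g i
funToFin-injective {m} {n} {f} {g} eq i = trans (sym (finToFun-funToFin f i))
  (trans (cong (λ c → finToFun {n} {m} c i) eq) (finToFun-funToFin g i))

join-injective : ∀ m n (x y : Fin m ⊎ Fin n) → join m n x ≡ join m n y → x ≡ y
join-injective m n x y eq = trans (sym (splitAt-join m n x)) (trans (cong (splitAt m) eq) (splitAt-join m n y))

lookup-injective : ∀ {a n} {A : Set a} {xs ys : Vec A n} → (∀ i → lookup xs i ≡ lookup ys i) → xs ≡ ys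
lookup-injective {xs = xs} {ys} eq = trans (sym (tabulate∘lookup xs)) (trans (tabulate-cong eq) (tabulate∘lookup ys))

module Representative {M N} (class : Fin N → Fin M) where

  -- The index comes from a search and not from the given witness, so that it depends on the fibre
  -- alone; the witness only shows that the fibre is inhabited.
  pick : ∀ y → ∃[ i ] class i ≡ y → ∃[ i ] class i ≡ y
  pick y w with any? (λ i → class i Fin.≟ y)
  ... | yes v = v
  ... | no ¬v = contradiction w ¬v

  pick-irrelevant : ∀ y v w → pick y v ≡ pick y w
  pick-irrelevant y v w with any? (λ i → class i Fin.≟ y)
  ... | yes _ = refl
  ... | no ¬v = contradiction v ¬v

  rep : Fin N → Fin N
  rep i = proj₁ (pick (class i) (i , refl))

  class-rep : ∀ i → class (rep i) ≡ class i
  class-rep i = proj₂ (pick (class i) (i , refl))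

  rep-cong : ∀ {i j} → class i ≡ class j → rep i ≡ rep j
  rep-cong {i} {j} eq = go (class j) eq (j , refl)
    where
    -- The class is generalised to `y` so that the equation can be matched with `refl`; the two
    -- witnesses may then still differ.
    go : ∀ y (e : class i ≡ y) (w : ∃[ j ] class j ≡ y) → rep i ≡ proj₁ (pick y w)
    go y refl w = cong proj₁ (pick-irrelevant y (i , refl) w)

-- `Fin N` indexes the visible cubes for all directions together, and `t i`, `k i` are the direction
-- and height chosen for the cube `i`. Each axis of `[0, p)^d` is cut into `m` intervals of length
-- `s`.
module Counting {n p m s N : ℕ} .{{_ : NonZero p}} .{{_ : NonZero s}} (p-prime : Prime p) (p≤ms : p ≤ m * s)
  (t : Fin N → Vec (Fin p) n) (k : Fin N → Fin p)
  (tk-injective : ∀ {i j} → t i ≡ t j → k i ≡ k j → i ≡ j)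
  (antichain : ∀ {i j} → t i ≡ t j → toℕ (k i) < toℕ (k j) →
    ¬ (∀ l → toℕ (lookup (t i) l) * toℕ (k i) % p ≤ toℕ (lookup (t j) l) * toℕ (k j) % p)) where

  k̂ : Fin N → ℕ
  k̂ i = toℕ (k i)

  t̂ : Fin N → Fin n → ℕ
  t̂ i l = toℕ (lookup (t i) l)

  res : Fin N → Fin n → ℕ
  res i l = t̂ i l * k̂ i % p

  cell< : ∀ {a} → a < p → a / s < m
  cell< a<p = m<n*o⇒m/o<n (ℕₚ.<-≤-trans a<p p≤ms)

  res< : ∀ i l → res i l < p
  res< i l = m%n<n (t̂ i l * k̂ i) p

  -- The cell of side s containing the point (k, res), up to translation along (1, …, 1).
  diagonal : Fin N → Fin n → Fin (m + m)
  diagonal i l = fromℕ< {res i l / s + (m ∸ k̂ i / s)}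
    (ℕₚ.+-mono-<-≤ (cell< (res< i l)) (ℕₚ.m∸n≤m m (k̂ i / s)))

  diagonal-≡ : ∀ {i j} l → diagonal i l ≡ diagonal j l →
    res i l / s + (m ∸ k̂ i / s) ≡ res j l / s + (m ∸ k̂ j / s)
  diagonal-≡ l eq = fromℕ<-injective _ _ _ _ eq

  -- By the antichain property a class lies in a single cell for a single `t`; its representative is
  -- the fixed point of that cell.
  class : Fin N → Fin ((m + m) ^ n * p ^ n)
  class i = combine (funToFin (diagonal i)) (funToFin (lookup (t i)))

  open Representative class

  class-injective : ∀ {i j} → class i ≡ class j →
    funToFin (diagonal i) ≡ funToFin (diagonal j) × funToFin (lookup (t i)) ≡ funToFin (lookup (t j))
  class-injective {i} {j} = combine-injective (funToFin (diagonal i)) (funToFin (lookup (t i)))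
    (funToFin (diagonal j)) (funToFin (lookup (t j)))

  class⇒diagonal : ∀ {i j} → class i ≡ class j → ∀ l → diagonal i l ≡ diagonal j l
  class⇒diagonal eq = funToFin-injective (proj₁ (class-injective eq))

  class⇒t : ∀ {i j} → class i ≡ class j → t i ≡ t j
  class⇒t {i} {j} eq = lookup-injective (funToFin-injective (proj₂ (class-injective eq)))

  -- Of two distinct cells on one diagonal, one is smaller in every coordinate, so an
  -- antichain meets at most one cell of each diagonal.
  cell-≮ : ∀ {i j} → class i ≡ class j → ¬ (k̂ i / s < k̂ j / s)
  cell-≮ {i} {j} eq lt = antichain (class⇒t eq) (m/o<n/o⇒m<n lt) λ l →
    ℕₚ.<⇒≤ (m/o<n/o⇒m<n (ℕₚ.≰⇒> λ resj≤resi →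
      ℕₚ.<-irrefl (sym (diagonal-≡ {i} {j} l (class⇒diagonal eq l)))
        (ℕₚ.+-mono-≤-< resj≤resi (ℕₚ.∸-monoʳ-< lt (ℕₚ.<⇒≤ (cell< (toℕ<n (k j))))))))

  same-cell-k : ∀ {i j} → class i ≡ class j → k̂ i / s ≡ k̂ j / s
  same-cell-k {i} {j} eq with ℕₚ.<-cmp (k̂ i / s) (k̂ j / s)
  ... | tri< lt _ _ = contradiction lt (cell-≮ eq)
  ... | tri≈ _ e _ = e
  ... | tri> _ _ gt = contradiction gt (cell-≮ (sym eq))

  -- The diagonal records `res / s − k / s`, shifted by `m` to stay nonnegative. Once the heights
  -- share an interval, this part cancels.
  same-cell-res : ∀ {i j} → class i ≡ class j → ∀ l → res i l / s ≡ res j l / s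
  same-cell-res {i} {j} eq l = ℕₚ.+-cancelʳ-≡ (m ∸ k̂ i / s) _ _
    (trans (diagonal-≡ {i} {j} l (class⇒diagonal eq l)) (cong (λ c → res j l / s + (m ∸ c)) (sym (same-cell-k eq))))

  k-near : ∀ {i j} → class i ≡ class j → k̂ i < k̂ j + s
  k-near eq = m/o≡n/o⇒m<n+o (same-cell-k eq)

  res-near : ∀ {i j} → class i ≡ class j → ∀ l → res i l < res j l + s
  res-near eq l = m/o≡n/o⇒m<n+o (same-cell-res eq l)

  -- The pair `(δ, u)` relative to the representative: the height first, then the residues, each
  -- shifted by `s`.
  offset : Fin N → Fin (suc n) → Fin (s + s)
  offset i = fromℕ< (m+o∸n<o+o {k̂ i} {k̂ (rep i)} (k-near (sym (class-rep i))) (k-near (class-rep i))) ◂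
    λ l → fromℕ< (m+o∸n<o+o {res i l} {res (rep i) l} (res-near (sym (class-rep i)) l) (res-near (class-rep i) l))

  -- By slope-unique, t need not be recorded together with a nonzero offset.
  code : ∀ i → Dec (k i ≡ k (rep i)) → Fin (p ^ n) ⊎ Fin ((s + s) ^ suc n)
  code i (yes _) = inj₁ (funToFin (lookup (t i)))
  code i (no _)  = inj₂ (funToFin (offset i))

  module _ {i j} (diag≡ : funToFin (diagonal i) ≡ funToFin (diagonal j)) where

    t≡⇒class≡ : t i ≡ t j → class i ≡ class j
    t≡⇒class≡ eq = cong₂ combine diag≡ (cong (λ v → funToFin (lookup v)) eq)

    -- On a given diagonal, `t` determines the class and hence the representative. With
    -- `k i ≡ k (rep i)`, the cube is therefore determined by `t`. Otherwise the common offset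
    -- yields equal `t` by `slope-unique`, so the representatives agree and the common `δ` gives
    -- equal heights.
    code-injective : ∀ di dj → code i di ≡ code j dj → i ≡ j
    code-injective (yes ki≡) (yes kj≡) eq = tk-injective t≡ (trans ki≡ (trans (cong k (rep-cong (t≡⇒class≡ t≡))) (sym kj≡)))
      where
      t≡ : t i ≡ t j
      t≡ = lookup-injective (funToFin-injective (inj₁-injective eq))
    code-injective (no ki≢) (no kj≢) eq = tk-injective t≡ (toℕ-injective
      (ℕₚ.+-cancelʳ-≡ (k̂ (rep j)) _ _ (trans δ≡ (cong (λ r → k̂ j + k̂ r) (rep-cong (t≡⇒class≡ t≡))))))
      where
      offset≡ : ∀ l → offset i l ≡ offset j l
      offset≡ = funToFin-injective (inj₂-injective eq)
      δ≡ : k̂ i + k̂ (rep j) ≡ k̂ j + k̂ (rep i)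
      δ≡ = m+o∸n-injective (k-near (class-rep i)) (k-near (class-rep j)) (fromℕ<-injective _ _ _ _ (offset≡ Fin.zero))
      -- The representative shares its direction with `i`, so both residues are multiples of the
      -- same `t̂ i l`, as `slope-unique` requires.
      res-rep : ∀ i l → res (rep i) l ≡ t̂ i l * k̂ (rep i) % p
      res-rep i l = cong (λ v → toℕ (lookup v l) * k̂ (rep i) % p) (class⇒t (class-rep i))
      u≡ : ∀ l → t̂ i l * k̂ i % p + t̂ j l * k̂ (rep j) % p ≡ t̂ j l * k̂ j % p + t̂ i l * k̂ (rep i) % p
      u≡ l = subst₂ (λ x y → res i l + x ≡ res j l + y) (res-rep j l) (res-rep i l)
        (m+o∸n-injective (res-near (class-rep i) l) (res-near (class-rep j) l) (fromℕ<-injective _ _ _ _ (offset≡ (Fin.suc l))))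
      t≡ : t i ≡ t j
      t≡ = lookup-injective λ l → toℕ-injective
        (slope-unique p-prime (toℕ<n (lookup (t i) l)) (toℕ<n (lookup (t j) l)) (toℕ<n (k i)) (toℕ<n (k (rep i)))
          (λ e → ki≢ (toℕ-injective e)) δ≡ (u≡ l))
    code-injective (yes _) (no _) ()
    code-injective (no _) (yes _) ()

  same-rep? : ∀ i → Dec (k i ≡ k (rep i))
  same-rep? i = k i Fin.≟ k (rep i)

  residueCode : Fin N → Fin (p ^ n + (s + s) ^ suc n)
  residueCode i = join (p ^ n) ((s + s) ^ suc n) (code i (same-rep? i))

  encode : Fin N → Fin ((m + m) ^ n * (p ^ n + (s + s) ^ suc n))
  encode i = combine (funToFin (diagonal i)) (residueCode i)

  encode-injective : Injective _≡_ _≡_ encode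
  encode-injective {i} {j} eq = code-injective (proj₁ split) (same-rep? i) (same-rep? j)
    (join-injective (p ^ n) _ (code i (same-rep? i)) (code j (same-rep? j)) (proj₂ split))
    where split = combine-injective (funToFin (diagonal i)) (residueCode i) (funToFin (diagonal j)) (residueCode j) eq

  count : N ≤ (m + m) ^ n * (p ^ n + (s + s) ^ suc n)
  count = injective⇒≤ encode-injective

-- Choice of the cell size

^-distribʳ-* : ∀ m n o → (m * n) ^ o ≡ m ^ o * n ^ o
^-distribʳ-* m n zero    = refl
^-distribʳ-* m n (suc o) = trans (cong (λ x → m * n * x) (^-distribʳ-* m n o)) (swap m n (m ^ o) (n ^ o))
  where
  swap : ∀ a b c d → a * b * (c * d) ≡ a * c * (b * d)
  swap = ℕ-RingSolver.solve-∀

^-cancelˡ-≤ : ∀ {m n} o .{{_ : NonZero o}} → m ^ o ≤ n ^ o → m ≤ n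
^-cancelˡ-≤ o mᵒ≤nᵒ = ℕₚ.≮⇒≥ λ n<m → ℕₚ.<⇒≱ (ℕₚ.^-monoˡ-< o n<m) mᵒ≤nᵒ

^-swap : ∀ m n o → (m ^ n) ^ o ≡ (m ^ o) ^ n
^-swap m n o = trans (ℕₚ.^-*-assoc m n o) (trans (cong (m ^_) (ℕₚ.*-comm n o)) (sym (ℕₚ.^-*-assoc m o n)))

-- Induction on `p`: `m` is doubled only when `m ^ d` equals the old `p`, and then `(2 m) ^ d` is
-- exactly `2 ^ d` times the old `p`.
root-up-to-2 : ∀ d p .{{_ : NonZero d}} .{{_ : NonZero p}} → ∃[ m ] p ≤ m ^ d × m ^ d ≤ 2 ^ d * p
root-up-to-2 d 1 = 1 , ℕₚ.≤-reflexive (sym (ℕₚ.^-zeroˡ d)) , (begin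
  1 ^ d        ≤⟨ ℕₚ.^-monoˡ-≤ d (ℕ.s≤s ℕ.z≤n) ⟩
  2 ^ d        ≡⟨ ℕₚ.*-identityʳ (2 ^ d) ⟨
  2 ^ d * 1    ∎)
  where open ℕₚ.≤-Reasoning
root-up-to-2 d (suc p@(suc _)) with root-up-to-2 d p
... | m , p≤mᵈ , mᵈ≤2ᵈp with ℕₚ.m≤n⇒m<n∨m≡n p≤mᵈ
...   | inj₁ p<mᵈ = m , p<mᵈ , ℕₚ.≤-trans mᵈ≤2ᵈp (ℕₚ.*-monoʳ-≤ (2 ^ d) (ℕₚ.n≤1+n p))
...   | inj₂ p≡mᵈ = 2 * m , 1+p≤ , ≤2ᵈ[1+p]
  where
  open ℕₚ.≤-Reasoning
  2≤2ᵈ : 2 ≤ 2 ^ d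
  2≤2ᵈ = ℕₚ.^-monoʳ-≤ 2 (ℕ.>-nonZero⁻¹ d)
  1+p≤ : suc p ≤ (2 * m) ^ d
  1+p≤ = begin
    1 + p            ≤⟨ ℕₚ.+-monoˡ-≤ p (ℕ.s≤s ℕ.z≤n) ⟩
    p + p            ≡⟨ cong (λ x → p + x) (ℕₚ.+-identityʳ p) ⟨
    2 * p            ≤⟨ ℕₚ.*-monoˡ-≤ p 2≤2ᵈ ⟩
    2 ^ d * p        ≡⟨ cong (λ x → 2 ^ d * x) p≡mᵈ ⟩
    2 ^ d * m ^ d    ≡⟨ ^-distribʳ-* 2 m d ⟨
    (2 * m) ^ d      ∎
  ≤2ᵈ[1+p] : (2 * m) ^ d ≤ 2 ^ d * suc p
  ≤2ᵈ[1+p] = begin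
    (2 * m) ^ d      ≡⟨ ^-distribʳ-* 2 m d ⟩
    2 ^ d * m ^ d    ≡⟨ cong (λ x → 2 ^ d * x) p≡mᵈ ⟨
    2 ^ d * p        ≤⟨ ℕₚ.*-monoʳ-≤ (2 ^ d) (ℕₚ.n≤1+n p) ⟩
    2 ^ d * suc p    ∎

-- 2 ^ n (1 + 6 ^ d) from Balance.bound, and 2 ^ n again because m is the d-th root of p
-- only up to a factor of 2.
constant : ℕ → ℕ
constant n = 2 ^ n * (1 + 6 ^ suc n) * 2 ^ n

module Balance {n p m} .{{_ : NonZero p}} .{{_ : NonZero m}}
  (p≤mᵈ : p ≤ m ^ suc n) (mᵈ≤2ᵈp : m ^ suc n ≤ 2 ^ suc n * p) where

  open ℕₚ.≤-Reasoning

  d = suc n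
  -- Rounding up makes the side nonzero and lets `m` intervals cover `[0, p)`.
  s = suc (p / m)

  p≤ms : p ≤ m * s
  p≤ms = begin
    p                    ≡⟨ m≡m%n+[m/n]*n p m ⟩
    p % m + p / m * m    ≤⟨ ℕₚ.+-monoˡ-≤ (p / m * m) (ℕₚ.<⇒≤ (m%n<n p m)) ⟩
    s * m                ≡⟨ ℕₚ.*-comm s m ⟩
    m * s                ∎

  -- Absorbs the rounding in `s`, since `s * m ≤ p + m`.
  m≤2p : m ≤ 2 * p
  m≤2p = ^-cancelˡ-≤ d (begin
    m ^ d            ≤⟨ mᵈ≤2ᵈp ⟩
    2 ^ d * p        ≡⟨ cong (λ x → 2 ^ d * x) (ℕₚ.*-identityʳ p) ⟨
    2 ^ d * p ^ 1    ≤⟨ ℕₚ.*-monoʳ-≤ (2 ^ d) (ℕₚ.^-monoʳ-≤ p {1} {d} (ℕ.s≤s ℕ.z≤n)) ⟩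
    2 ^ d * p ^ d    ≡⟨ ^-distribʳ-* 2 p d ⟨
    (2 * p) ^ d      ∎)

  sm≤3p : s * m ≤ 3 * p
  sm≤3p = begin
    m + p / m * m    ≤⟨ ℕₚ.+-mono-≤ m≤2p (m/n*n≤m p m) ⟩
    2 * p + p        ≡⟨ ℕₚ.+-comm (2 * p) p ⟩
    3 * p            ∎

  -- After multiplication by `p`, the bound `p ≤ m ^ d` turns the left side into `(s * m) ^ d`. The
  -- number of offsets is thus of the same order as the number `p ^ n` of directions.
  sᵈ≤3ᵈpⁿ : s ^ d ≤ 3 ^ d * p ^ n
  sᵈ≤3ᵈpⁿ = ℕₚ.*-cancelʳ-≤ (s ^ d) (3 ^ d * p ^ n) p (begin
    s ^ d * p              ≤⟨ ℕₚ.*-monoʳ-≤ (s ^ d) p≤mᵈ ⟩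
    s ^ d * m ^ d          ≡⟨ ^-distribʳ-* s m d ⟨
    (s * m) ^ d            ≤⟨ ℕₚ.^-monoˡ-≤ d sm≤3p ⟩
    (3 * p) ^ d            ≡⟨ ^-distribʳ-* 3 p d ⟩
    3 ^ d * p ^ d          ≡⟨ cong (λ x → 3 ^ d * x) (ℕₚ.*-comm p (p ^ n)) ⟩
    3 ^ d * (p ^ n * p)    ≡⟨ ℕₚ.*-assoc (3 ^ d) (p ^ n) p ⟨
    3 ^ d * p ^ n * p      ∎)

  double : ∀ a → a + a ≡ 2 * a
  double a = cong (λ x → a + x) (sym (ℕₚ.+-identityʳ a))

  [2s]ᵈ≤6ᵈpⁿ : (s + s) ^ d ≤ 6 ^ d * p ^ n
  [2s]ᵈ≤6ᵈpⁿ = begin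
    (s + s) ^ d                ≡⟨ cong (_^ d) (double s) ⟩
    (2 * s) ^ d                ≡⟨ ^-distribʳ-* 2 s d ⟩
    2 ^ d * s ^ d              ≤⟨ ℕₚ.*-monoʳ-≤ (2 ^ d) sᵈ≤3ᵈpⁿ ⟩
    2 ^ d * (3 ^ d * p ^ n)    ≡⟨ ℕₚ.*-assoc (2 ^ d) (3 ^ d) (p ^ n) ⟨
    2 ^ d * 3 ^ d * p ^ n      ≡⟨ cong (_* p ^ n) (^-distribʳ-* 2 3 d) ⟨
    6 ^ d * p ^ n              ∎

  bound : (m + m) ^ n * (p ^ n + (s + s) ^ d) ≤ 2 ^ n * (1 + 6 ^ d) * (m ^ n * p ^ n)
  bound = begin
    (m + m) ^ n * (p ^ n + (s + s) ^ d)      ≤⟨ ℕₚ.*-monoʳ-≤ ((m + m) ^ n) (ℕₚ.+-monoʳ-≤ (p ^ n) [2s]ᵈ≤6ᵈpⁿ) ⟩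
    (m + m) ^ n * ((1 + 6 ^ d) * p ^ n)      ≡⟨ cong (λ x → x ^ n * ((1 + 6 ^ d) * p ^ n)) (double m) ⟩
    (2 * m) ^ n * ((1 + 6 ^ d) * p ^ n)      ≡⟨ cong (_* ((1 + 6 ^ d) * p ^ n)) (^-distribʳ-* 2 m n) ⟩
    2 ^ n * m ^ n * ((1 + 6 ^ d) * p ^ n)    ≡⟨ swap (2 ^ n) (m ^ n) (1 + 6 ^ d) (p ^ n) ⟩
    2 ^ n * (1 + 6 ^ d) * (m ^ n * p ^ n)    ∎
    where
    swap : ∀ a b c e → a * b * (c * e) ≡ a * c * (b * e)
    swap = ℕ-RingSolver.solve-∀

  -- The `d`-th power replaces the approximate root `m` by `m ^ d`, which is at most `2 ^ d * p`.
  -- The resulting exponent `n + n * d` is `d² − 1`.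
  bound^d : ((m + m) ^ n * (p ^ n + (s + s) ^ d)) ^ d ≤ constant n ^ d * p ^ (n + n * d)
  bound^d = begin
    ((m + m) ^ n * (p ^ n + (s + s) ^ d)) ^ d      ≤⟨ ℕₚ.^-monoˡ-≤ d bound ⟩
    (c * (m ^ n * p ^ n)) ^ d                      ≡⟨ ^-distribʳ-* c (m ^ n * p ^ n) d ⟩
    c ^ d * (m ^ n * p ^ n) ^ d                    ≡⟨ cong (λ x → c ^ d * x) (^-distribʳ-* (m ^ n) (p ^ n) d) ⟩
    c ^ d * ((m ^ n) ^ d * (p ^ n) ^ d)            ≤⟨ ℕₚ.*-monoʳ-≤ (c ^ d) (ℕₚ.*-monoˡ-≤ ((p ^ n) ^ d) [mⁿ]ᵈ≤) ⟩
    c ^ d * ((2 ^ n) ^ d * p ^ n * (p ^ n) ^ d)    ≡⟨ cong (λ x → c ^ d * ((2 ^ n) ^ d * p ^ n * x)) (ℕₚ.^-*-assoc p n d) ⟩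
    c ^ d * ((2 ^ n) ^ d * p ^ n * p ^ (n * d))    ≡⟨ assoc (c ^ d) ((2 ^ n) ^ d) (p ^ n) (p ^ (n * d)) ⟩
    c ^ d * (2 ^ n) ^ d * (p ^ n * p ^ (n * d))    ≡⟨ cong₂ _*_ (^-distribʳ-* c (2 ^ n) d) (ℕₚ.^-distribˡ-+-* p n (n * d)) ⟨
    constant n ^ d * p ^ (n + n * d)               ∎
    where
    c = 2 ^ n * (1 + 6 ^ d)
    assoc : ∀ a b x y → a * (b * x * y) ≡ a * b * (x * y)
    assoc = ℕ-RingSolver.solve-∀
    [mⁿ]ᵈ≤ : (m ^ n) ^ d ≤ (2 ^ n) ^ d * p ^ n
    [mⁿ]ᵈ≤ = begin
      (m ^ n) ^ d            ≡⟨ ^-swap m n d ⟩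
      (m ^ d) ^ n            ≤⟨ ℕₚ.^-monoˡ-≤ n mᵈ≤2ᵈp ⟩
      (2 ^ d * p) ^ n        ≡⟨ ^-distribʳ-* (2 ^ d) p n ⟩
      (2 ^ d) ^ n * p ^ n    ≡⟨ cong (_* p ^ n) (^-swap 2 d n) ⟩
      (2 ^ n) ^ d * p ^ n    ∎

-- Rational powers and comparison with `C p^(d - 1/d) log p`

fromℕ-homo-^ : ∀ m o → fromℕ (m ^ o) ≡ fromℕ m ^ℚ o
fromℕ-homo-^ m zero    = refl
fromℕ-homo-^ m (suc o) = trans (fromℕ-homo-* m (m ^ o)) (cong (fromℕ m ℚ.*_) (fromℕ-homo-^ m o))

^ℚ-mono-< : ∀ {p q} o → 0ℚ ℚ.≤ p → p ℚ.< q → p ^ℚ suc o ℚ.< q ^ℚ suc o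
^ℚ-mono-< {p} {q} zero 0≤p p<q = subst₂ ℚ._<_ (sym (ℚₚ.*-identityʳ p)) (sym (ℚₚ.*-identityʳ q)) p<q
^ℚ-mono-< {p} {q} (suc o) 0≤p p<q = ℚₚ.≤-<-trans
  (ℚₚ.*-monoˡ-≤-nonNeg p {{ℚ.nonNegative 0≤p}} (ℚₚ.<⇒≤ pᵒ<qᵒ))
  (ℚₚ.*-monoˡ-<-pos (q ^ℚ suc o) {{ℚ.positive (ℚₚ.≤-<-trans (0≤^ (suc o)) pᵒ<qᵒ)}} p<q)
  where
  pᵒ<qᵒ = ^ℚ-mono-< o 0≤p p<q
  0≤^ : ∀ o → 0ℚ ℚ.≤ p ^ℚ o
  0≤^ zero    = 0≤fromℕ 1
  0≤^ (suc o) = 0≤* 0≤p (0≤^ o)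

^ℚ-cancel-≤ : ∀ {p q} o → 0ℚ ℚ.≤ q → p ^ℚ suc o ℚ.≤ q ^ℚ suc o → p ℚ.≤ q
^ℚ-cancel-≤ o 0≤q pᵒ≤qᵒ = ℚₚ.≮⇒≥ λ q<p → ℚₚ.<-irrefl refl (ℚₚ.<-≤-trans (^ℚ-mono-< o 0≤q q<p) pᵒ≤qᵒ)

-- This discards the factor log p of the bound, which the argument does not need.
1≤log : ∀ {p} → 2 ≤ p → ∀ ℓ → Log≤ p ℓ → 1ℚ ℚ.≤ ℓ
1≤log {p} 2≤p ℓ@(ℚ.mkℚ (+ a) b-1 _) (_ , pᵇ≤2ᵃ) = ℚ.*≤* (subst₂ ℤ._≤_
  (sym (ℤₚ.*-identityˡ (+ suc b-1))) (sym (ℤₚ.*-identityʳ (+ a))) (ℤ.+≤+ b≤a))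
  where
  b≤a : suc b-1 ≤ a
  b≤a = ℕₚ.≮⇒≥ λ a<b → ℕₚ.<⇒≱ (ℕₚ.^-monoʳ-< 2 (ℕₚ.n<1+n 1) a<b)
    (ℕₚ.≤-trans (ℕₚ.^-monoˡ-≤ (suc b-1) 2≤p) pᵇ≤2ᵃ)
1≤log 2≤p ℓ@(ℚ.mkℚ (ℤ.-[1+ a ]) b-1 _) (ℚ.*≤* () , _)

-- The bound `r` is known only through `r ^ d`, so `N` and `C r` are compared by their `d`-th
-- powers; a logarithm of at least 1 then enlarges the right side.
power-bound : ∀ {N C p n} → 2 ≤ p → N ^ suc n ≤ C ^ suc n * p ^ (n + n * suc n) →
  N ≤ C ·p^[d-1/d]·log[p= p ,d= suc n ]
power-bound {N} {C} {p} {n} 2≤p Nᵈ≤ r ℓ (0≤r , pow≤rᵈ) log≤ℓ = begin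
  fromℕ N                 ≤⟨ ^ℚ-cancel-≤ n 0≤Cr Nᵈ≤[Cr]ᵈ ⟩
  fromℕ C ℚ.* r           ≡⟨ ℚₚ.*-identityʳ (fromℕ C ℚ.* r) ⟨
  fromℕ C ℚ.* r ℚ.* 1ℚ    ≤⟨ ℚₚ.*-monoˡ-≤-nonNeg (fromℕ C ℚ.* r) {{ℚ.nonNegative 0≤Cr}} (1≤log 2≤p ℓ log≤ℓ) ⟩
  fromℕ C ℚ.* r ℚ.* ℓ     ∎
  where
  open ℚₚ.≤-Reasoning
  d = suc n
  0≤Cr : 0ℚ ℚ.≤ fromℕ C ℚ.* r
  0≤Cr = 0≤* (0≤fromℕ C) 0≤r
  Nᵈ≤[Cr]ᵈ : fromℕ N ^ℚ d ℚ.≤ (fromℕ C ℚ.* r) ^ℚ d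
  Nᵈ≤[Cr]ᵈ = begin
    fromℕ N ^ℚ d                                 ≡⟨ fromℕ-homo-^ N d ⟨
    fromℕ (N ^ d)                                ≤⟨ fromℕ-mono-≤ Nᵈ≤ ⟩
    fromℕ (C ^ d * p ^ (n + n * d))              ≡⟨ fromℕ-homo-* (C ^ d) (p ^ (n + n * d)) ⟩
    -- `d * d ∸ 1` computes to `n + n * d`, so `pow≤rᵈ` applies as it stands.
    fromℕ (C ^ d) ℚ.* fromℕ (p ^ (n + n * d))    ≤⟨ ℚₚ.*-monoˡ-≤-nonNeg (fromℕ (C ^ d)) {{ℚ.nonNegative (0≤fromℕ (C ^ d))}} pow≤rᵈ ⟩
    fromℕ (C ^ d) ℚ.* r ^ℚ d                     ≡⟨ cong (ℚ._* r ^ℚ d) (fromℕ-homo-^ C d) ⟩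
    fromℕ C ^ℚ d ℚ.* r ^ℚ d                      ≡⟨ ^ℚ-distrib-* (fromℕ C) r d ⟨
    (fromℕ C ℚ.* r) ^ℚ d                         ∎

-- Counting the visible cubes

Unique⇒lookup-injective : ∀ {a} {A : Set a} {xs : List A} → Unique xs →
  ∀ i j → List.lookup xs i ≡ List.lookup xs j → i ≡ j
Unique⇒lookup-injective (x∉ ∷ u) Fin.zero    Fin.zero    eq = refl
Unique⇒lookup-injective (x∉ ∷ u) Fin.zero    (Fin.suc j) eq = contradiction eq (ListAll.lookup x∉ (∈-lookup j))
Unique⇒lookup-injective (x∉ ∷ u) (Fin.suc i) Fin.zero    eq = contradiction (sym eq) (ListAll.lookup x∉ (∈-lookup i))
Unique⇒lookup-injective (x∉ ∷ u) (Fin.suc i) (Fin.suc j) eq = cong Fin.suc (Unique⇒lookup-injective u i j eq)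

-- Each cube is charged to the one direction and height that its proof of visibility supplies, even
-- if it is visible through several directions.
visible-count : ∀ {n p m s} .{{_ : NonZero p}} .{{_ : NonZero s}} → Prime p → p ≤ m * s →
  (𝒪 : Pred (Cube (suc n) p) 0ℓ) (cs : List (Cube (suc n) p)) → Unique cs → All (Visible 𝒪) cs →
  length cs ≤ (m + m) ^ n * (p ^ n + (s + s) ^ suc n)
visible-count {n} {p} {m} {s} p-prime p≤ms 𝒪 cs unique visible =
  Counting.count {m = m} {s} p-prime p≤ms t k tk-injective antichain
  where
  vis : ∀ i → Visible 𝒪 (List.lookup cs i)
  vis i = ListAll.lookup visible (∈-lookup i)
  t : Fin (length cs) → Vec (Fin p) n
  t i = proj₁ (proj₂ (vis i))
  k : Fin (length cs) → Fin p
  k i = proj₁ (proj₂ (proj₂ (vis i)))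
  c≡Q : ∀ i → List.lookup cs i ≡ Q (t i) (k i)
  c≡Q i = proj₁ (proj₂ (proj₂ (proj₂ (vis i))))
  tk-injective : ∀ {i j} → t i ≡ t j → k i ≡ k j → i ≡ j
  tk-injective {i} {j} t≡ k≡ = Unique⇒lookup-injective unique i j
    (trans (c≡Q i) (trans (cong₂ Q t≡ k≡) (sym (c≡Q j))))
  -- The lower cube is visible, hence obstructing, and its facet would meet the very line of sight
  -- by which the higher cube is seen.
  antichain : ∀ {i j} → t i ≡ t j → toℕ (k i) < toℕ (k j) →
    ¬ (∀ l → toℕ (lookup (t i) l) * toℕ (k i) % p ≤ toℕ (lookup (t j) l) * toℕ (k j) % p)
  antichain {i} {j} t≡ ki<kj r≤ = blocked (proj₂ (proj₂ (proj₂ (proj₂ (vis j)))))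
    where
    Qi∈𝒪 : Q (t j) (k i) ∈ 𝒪
    Qi∈𝒪 = subst (_∈ 𝒪) (trans (c≡Q i) (cong (λ v → Q v (k i)) t≡)) (proj₁ (vis i))
    r≤′ : ∀ l → toℕ (lookup (t j) l) * toℕ (k i) % p ≤ toℕ (lookup (t j) l) * toℕ (k j) % p
    r≤′ = subst (λ v → ∀ l → toℕ (lookup v l) * toℕ (k i) % p ≤ toℕ (lookup (t j) l) * toℕ (k j) % p) t≡ r≤
    blocked : Σ[ x ∈ Vec ℝ n ] VecAll.All (λ xᵢ → 0ᴿ ≤ᴿ xᵢ × xᵢ ≤ᴿ 1ᴿ) x × MeetsFacet (t j) x (k j) ×
      (∀ k′ → k′ Fin.< k j → Q (t j) k′ ∈ 𝒪 → ¬ MeetsFacet (t j) x k′) → ⊥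
    blocked (x , 0≤x≤1 , meets , unblocked) =
      unblocked (k i) ki<kj Qi∈𝒪 (meetsFacet-antitone (t j) x (k j) (k i) 0≤x≤1 r≤′ meets)

visible-count^d : ∀ {n p} → Prime p →
  (𝒪 : Pred (Cube (suc n) p) 0ℓ) (cs : List (Cube (suc n) p)) → Unique cs → All (Visible 𝒪) cs →
  length cs ^ suc n ≤ constant n ^ suc n * p ^ (n + n * suc n)
visible-count^d {n} {p} p-prime 𝒪 cs unique visible = from-root (root-up-to-2 (suc n) p)
  where
  instance
    p≢0 : NonZero p
    p≢0 = prime⇒nonZero p-prime
  from-root : ∃[ m ] p ≤ m ^ suc n × m ^ suc n ≤ 2 ^ suc n * p →
    length cs ^ suc n ≤ constant n ^ suc n * p ^ (n + n * suc n)
  from-root (zero , p≤0 , _) = contradiction p≤0 (ℕₚ.<⇒≱ (ℕ.>-nonZero⁻¹ p))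
  from-root (m@(suc _) , p≤mᵈ , mᵈ≤2ᵈp) = ℕₚ.≤-trans
    (ℕₚ.^-monoˡ-≤ (suc n) (visible-count {m = m} p-prime p≤ms 𝒪 cs unique visible)) bound^d
    where open Balance {n} {p} {m} p≤mᵈ mᵈ≤2ᵈp

theorem7p2 : ∀ n → 2 < suc n →
    ∃[ C ] (∀ p → Prime p → (𝒪 : Pred (Cube (suc n) p) 0ℓ) →
    ∀ (cs : List (Cube (suc n) p)) → Unique cs → All (Visible 𝒪) cs →
    length cs ≤ C ·p^[d-1/d]·log[p= p ,d= suc n ])
theorem7p2 n _ = constant n , λ p p-prime 𝒪 cs unique visible →
  power-bound {length cs} {constant n} {p} {n} (ℕ.nonTrivial⇒n>1 p {{prime⇒nonTrivial p-prime}})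
    (visible-count^d p-prime 𝒪 cs unique visible)
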